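{- Let $n$ and $t$ be positive integers and let $m_1\geq m_2\geq\cdots\geq m_t\geq 2$ be integers. Let $F_1=2K_{1,n}$ and $F_2=\bigsqcup_{i=1}^t K_{1,m_i}$. Then $$\hat{r}(F_1,F_2)=n+m_1-1+\sum_{i=1}^{t}(n+m_i-1).$$
   Context: All graphs are undirected, simple, finite and without isolated vertices. $K_{1,n}$ is the star with one root vertex joined to $n$ leaves. $\sqcup$ denotes disjoint union of graphs, and $2K_{1,n}$ is the disjoint union of two copies of $K_{1,n}$. For graphs $F_1,F_2,G$, write $G\rightarrow(F_1,F_2)$ if for every coloring of the edges of $G$ by red and blue there is either a red copy of $F_1$ or a blue copy of $F_2$ in $G$ (copies are subgraphs, not necessarily induced). The size Ramsey number $\hat{r}(F_1,F_2)$ is the minimum number of edges of a graph $G$ such that $G\rightarrow(F_1,F_2)$. -}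

module Defs where

open import Algebra.Properties.CommutativeMonoid.Sum as Sum using ()
open import Data.Bool using (Bool; true; false; T; _∧_; if_then_else_)
open import Data.Fin using (Fin; zero; suc; splitAt; _<?_)
open import Data.Nat using (ℕ; zero; suc; _+_; _≤_)
open import Data.Nat.Properties using (+-0-commutativeMonoid)
open import Data.Product using (∃-syntax; Σ-syntax; _×_)
open import Data.Sum using (_⊎_; inj₁; inj₂)
open import Function.Base using (_∘_)
open import Function.Definitions using (Injective)
open import Relation.Binary.PropositionalEquality using (_≡_; refl; subst)
open import Relation.Nullary using (does)

open Sum +-0-commutativeMonoid public using (sum)

-- Finite simple graphs.  Isolated vertices are allowed here and excluded by
-- NoIsolated where graphs are quantified over (in IsSizeRamsey).
record Graph : Set where
  field
    order      : ℕ
    adj        : Fin order → Fin order → Bool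
    adj-sym    : ∀ u v → adj u v ≡ adj v u
    adj-irrefl : ∀ u → adj u u ≡ false

  Vertex : Set
  Vertex = Fin order

  _~_ : Vertex → Vertex → Set
  u ~ v = T (adj u v)

  ~-sym : ∀ {u v} → u ~ v → v ~ u
  ~-sym {u} {v} = subst T (adj-sym u v)

  NoIsolated : Set
  NoIsolated = ∀ u → ∃[ v ] u ~ v

  -- Each edge {u , v} is counted once, as the pair with u < v.
  size : ℕ
  size = sum λ u → sum λ v → if does (u <? v) ∧ adj u v then 1 else 0

-- The root is vertex zero.
star : ℕ → Graph
star n = record
  { order = suc n ; adj = a ; adj-sym = a-sym ; adj-irrefl = a-irrefl }
  where
  a : Fin (suc n) → Fin (suc n) → Bool
  a zero    zero    = false
  a zero    (suc _) = true
  a (suc _) zero    = true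
  a (suc _) (suc _) = false

  a-sym : ∀ u v → a u v ≡ a v u
  a-sym zero    zero    = refl
  a-sym zero    (suc _) = refl
  a-sym (suc _) zero    = refl
  a-sym (suc _) (suc _) = refl

  a-irrefl : ∀ u → a u u ≡ false
  a-irrefl zero    = refl
  a-irrefl (suc _) = refl

infixr 5 _⊔ᴳ_

_⊔ᴳ_ : Graph → Graph → Graph
G ⊔ᴳ H = record
  { order      = G.order + H.order
  ; adj        = λ u v → a (splitAt G.order u) (splitAt G.order v)
  ; adj-sym    = λ u v → a-sym (splitAt G.order u) (splitAt G.order v)
  ; adj-irrefl = λ u → a-irrefl (splitAt G.order u)
  }
  where
  module G = Graph G
  module H = Graph H

  a : G.Vertex ⊎ H.Vertex → G.Vertex ⊎ H.Vertex → Bool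
  a (inj₁ u) (inj₁ v) = G.adj u v
  a (inj₁ _) (inj₂ _) = false
  a (inj₂ _) (inj₁ _) = false
  a (inj₂ u) (inj₂ v) = H.adj u v

  a-sym : ∀ x y → a x y ≡ a y x
  a-sym (inj₁ u) (inj₁ v) = G.adj-sym u v
  a-sym (inj₁ _) (inj₂ _) = refl
  a-sym (inj₂ _) (inj₁ _) = refl
  a-sym (inj₂ u) (inj₂ v) = H.adj-sym u v

  a-irrefl : ∀ x → a x x ≡ false
  a-irrefl (inj₁ u) = G.adj-irrefl u
  a-irrefl (inj₂ u) = H.adj-irrefl u

emptyGraph : Graph
emptyGraph = record
  { order = 0 ; adj = λ () ; adj-sym = λ () ; adj-irrefl = λ () }

⨆ : ∀ {t} → (Fin t → Graph) → Graph
⨆ {zero}  F = emptyGraph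
⨆ {suc t} F = F zero ⊔ᴳ ⨆ (F ∘ suc)

data Colour : Set where
  red blue : Colour

-- Only edges are coloured.  Since u ~ v has at most one proof, the colour
-- depends on u and v alone, and by colour-sym only on the edge {u , v}.
record Colouring (G : Graph) : Set where
  open Graph G
  field
    colour     : ∀ {u v} → u ~ v → Colour
    colour-sym : ∀ {u v} (e : u ~ v) → colour (~-sym e) ≡ colour e

-- A (not necessarily induced) copy of F in G, all of whose edges have colour c.
record Copy (c : Colour) (F G : Graph) (χ : Colouring G) : Set where
  private
    module F = Graph F
    module G = Graph G
  open Colouring χ
  field
    embed     : F.Vertex → G.Vertex
    injective : Injective _≡_ _≡_ embed
    edge      : ∀ {u v} → u F.~ v → embed u G.~ embed v
    monochrom : ∀ {u v} (e : u F.~ v) → colour (edge e) ≡ c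

infix 4 _⟶⟨_,_⟩

_⟶⟨_,_⟩ : Graph → Graph → Graph → Set
G ⟶⟨ F₁ , F₂ ⟩ = (χ : Colouring G) → Copy red F₁ G χ ⊎ Copy blue F₂ G χ

IsMinimum : (ℕ → Set) → ℕ → Set
IsMinimum P r = P r × (∀ k → P k → r ≤ k)

-- IsSizeRamsey F₁ F₂ r says that the size Ramsey number of (F₁ , F₂) is r.
IsSizeRamsey : Graph → Graph → ℕ → Set
IsSizeRamsey F₁ F₂ = IsMinimum λ k →
  Σ[ G ∈ Graph ] Graph.NoIsolated G × G ⟶⟨ F₁ , F₂ ⟩ × Graph.size G ≡ k

{-# OPTIONS --safe #-}
module Submission where

-- Write n = a + 1, and let F₂ be the forest of the stars K(1, mᵢ).
--
-- Upper bound.  Take the disjoint union of the stars with n + mᵢ - 1 rays and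
-- of one more star with n + m₁ - 1 rays.  By the pigeonhole principle each of
-- these stars contains a red K(1, n) or a blue star with as many rays as its
-- index asks for.  Either two of them contain a red K(1, n), or all but one
-- contain their blue star, and then the extra star, whose blue star has m₁
-- rays, can stand in for the exceptional one.
--
-- Lower bound.  Let G arrow (2 K(1, n), F₂), let E be a set of edges such that
-- no vertex lies on n edges of G outside E, and let w be a vertex.  Colour blue
-- the edges of E that are not at w.  Every red K(1, n) then contains w, so no
-- two are disjoint and there is a blue F₂: E contains a copy of F₂ avoiding w
-- (robust).  This has two consequences.
--
--  * E has at least m₁ + ∑ mᵢ edges: take a copy of F₂ in E, let c be the
--    centre of its star K(1, m₁), and take a second copy avoiding c.  The edges
--    of that star and of the second copy are distinct (final).
--
--  * E contains a matching of t + 1 edges.  Cutting the stars down to two rays,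
--    which is possible as mᵢ ≥ 2, gives two families of t disjoint paths on
--    three vertices, and the centre c of a path of the first family is avoided
--    by the second.  Such families force a matching of t + 1 edges by an
--    induction that exchanges the roles of the families (cherryMatching).
--
-- Starting from the edge set of G, delete a matching of t + 1 edges a times
-- (peel).  After b rounds a vertex has lost at most b edges, so both
-- consequences apply throughout, and G has at least
-- a (t + 1) + m₁ + ∑ mᵢ = (n + m₁ - 1) + ∑ (n + mᵢ - 1) edges.

open import Defs
open import Data.Bool using (Bool; true; false; T; _∧_; _∨_; not; if_then_else_)
open import Data.Bool.Properties using (∨-comm; ∧-identityʳ; ∧-zeroʳ; T?)
open import Data.Fin as Fin using (Fin; zero; suc; fromℕ<; toℕ; punchIn; punchOut; inject≤; splitAt; join; _<?_; _↑ˡ_; _↑ʳ_)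
open import Data.Fin.Properties
  using ( _≟_; any?; suc-injective; punchIn-injective; punchInᵢ≢i; punchIn-punchOut; <-cmp; <-asym
        ; inject≤-injective; splitAt-↑ˡ; splitAt-↑ʳ; splitAt⁻¹-↑ˡ; splitAt⁻¹-↑ʳ; join-splitAt
        ; ↑ˡ-injective; ↑ʳ-injective; toℕ-↑ˡ; toℕ-fromℕ<)
open import Data.Nat using (ℕ; zero; suc; _+_; _*_; _∸_; _≤_; _<_; z≤n; s≤s)
open import Data.Nat.Properties
  using ( +-0-commutativeMonoid; +-0-monoid; +-suc; +-assoc; +-comm; *-comm; +-identityʳ; +-monoʳ-≤
        ; ≤-refl; ≤-trans; <⇒≤; m≤n+m; m≤n+m∸n; module ≤-Reasoning)
open import Data.Product using (_×_; _,_; proj₁; proj₂; ∃-syntax; Σ-syntax)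
open import Data.Sum as Sum using (_⊎_; inj₁; inj₂; [_,_]′)
open import Data.Unit using (tt)
open import Algebra.Properties.CommutativeMonoid.Sum +-0-commutativeMonoid using (∑-distrib-+)
open import Algebra.Properties.Monoid.Sum +-0-monoid using (sum-cong-≗)
open import Function.Base using (_∘_; id; const; case_of_; _⟨_⟩_)
open import Function.Definitions using (Injective)
open import Relation.Binary using (tri<; tri≈; tri>)
open import Relation.Binary.PropositionalEquality
  using (_≡_; _≢_; refl; sym; trans; cong; cong₂; subst)
open import Relation.Nullary using (Dec; yes; no; ¬_; does; contradiction)
open import Relation.Nullary.Decidable using (_×-dec_; _⊎-dec_; dec-true; dec-false)

-- Star forests

-- A copy of the disjoint union of the stars K(1, m i) in the graph with
-- adjacency relation E, not necessarily induced.  The vertices of the i-th star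
-- are node i zero, its centre, and node i (suc a), its leaves.
record StarForest {V : Set} (E : V → V → Set) {t : ℕ} (m : Fin t → ℕ) : Set where
  field
    node     : ∀ i → Fin (suc (m i)) → V
    node-inj : ∀ i {a b} → node i a ≡ node i b → a ≡ b
    disjoint : ∀ {i j} → i ≢ j → ∀ a b → node i a ≢ node j b
    edge     : ∀ i a → E (node i zero) (node i (suc a))

open StarForest

-- The vertex w does not lie on the forest.
Avoids : ∀ {V : Set} {E : V → V → Set} {t} {m : Fin t → ℕ} → StarForest E m → V → Set
Avoids F w = ∀ i a → node F i a ≢ w

-- The map that fixes zero and sends suc a to suc (f a).
extend : ∀ {p q} → (Fin p → Fin q) → Fin (suc p) → Fin (suc q)
extend = Fin.lift 1

extend-injective : ∀ {p q} {f : Fin p → Fin q} →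
  Injective _≡_ _≡_ f → Injective _≡_ _≡_ (extend f)
extend-injective inj {zero}  {zero}  _  = refl
extend-injective inj {suc _} {suc _} eq = cong suc (inj (suc-injective eq))

-- The forest whose i-th star keeps the centre of the star σ i of F and only the
-- leaves listed by q i.  The relation may change, as long as it holds along the
-- rays that are kept.
subforest : ∀ {V : Set} {E E′ : V → V → Set} {s t} {m : Fin t → ℕ} {m′ : Fin s → ℕ}
  (F : StarForest E m) (σ : Fin s → Fin t) → Injective _≡_ _≡_ σ →
  (q : ∀ i → Fin (m′ i) → Fin (m (σ i))) → (∀ i → Injective _≡_ _≡_ (q i)) →
  (∀ i a → E′ (node F (σ i) zero) (node F (σ i) (suc (q i a)))) →
  StarForest E′ m′
subforest F σ σ-inj q q-inj e = record
  { node     = λ i → node F (σ i) ∘ extend (q i)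
  ; node-inj = λ i eq → extend-injective (q-inj i) (node-inj F (σ i) eq)
  ; disjoint = λ i≢j a b → disjoint F (i≢j ∘ σ-inj) _ _
  ; edge     = e
  }

reindex : ∀ {V : Set} {E : V → V → Set} {s t} {m : Fin t → ℕ}
  (F : StarForest E m) (σ : Fin s → Fin t) → Injective _≡_ _≡_ σ → StarForest E (m ∘ σ)
reindex F σ σ-inj = record
  { node     = node F ∘ σ
  ; node-inj = node-inj F ∘ σ
  ; disjoint = λ i≢j → disjoint F (i≢j ∘ σ-inj)
  ; edge     = edge F ∘ σ
  }

-- A matching of k edges, as k disjoint stars with a single ray.
Matching : ∀ {V : Set} → (V → V → Set) → ℕ → Set
Matching E k = StarForest E {k} (const 1)

-- k disjoint paths on three vertices, each presented with its middle vertex as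
-- the centre.
Cherries : ∀ {V : Set} → (V → V → Set) → ℕ → Set
Cherries E k = StarForest E {k} (const 2)

addEdge : ∀ {V : Set} {E : V → V → Set} {k} {u v} → E u v → u ≢ v →
  (M : Matching E k) → Avoids M u → Avoids M v → Matching E (suc k)
addEdge {V} {E} {k} {u} {v} uv u≢v M M∌u M∌v = record
  { node = nd ; node-inj = inj ; disjoint = dis
  ; edge = λ { zero zero → uv ; (suc i) a → edge M i a } }
  where
  nd : Fin (suc k) → Fin 2 → V
  nd zero    zero       = u
  nd zero    (suc zero) = v
  nd (suc i) a          = node M i a

  inj : ∀ i {a b} → nd i a ≡ nd i b → a ≡ b
  inj zero {zero}     {zero}     _  = refl
  inj zero {zero}     {suc zero} eq = contradiction eq u≢v
  inj zero {suc zero} {zero}     eq = contradiction (sym eq) u≢v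
  inj zero {suc zero} {suc zero} _  = refl
  inj (suc i) eq = node-inj M i eq

  dis : ∀ {i j} → i ≢ j → ∀ a b → nd i a ≢ nd j b
  dis {zero}  {zero}  i≢j _          _          = contradiction refl i≢j
  dis {zero}  {suc j} _   zero       b          = M∌u j b ∘ sym
  dis {zero}  {suc j} _   (suc zero) b          = M∌v j b ∘ sym
  dis {suc i} {zero}  _   a          zero       = M∌u i a
  dis {suc i} {zero}  _   a          (suc zero) = M∌v i a
  dis {suc i} {suc j} i≢j a          b          = disjoint M (i≢j ∘ cong suc) a b

addEdge-avoids : ∀ {V : Set} {E : V → V → Set} {k} {u v w} (uv : E u v) (u≢v : u ≢ v)
  (M : Matching E k) (M∌u : Avoids M u) (M∌v : Avoids M v) →
  u ≢ w → v ≢ w → Avoids M w → Avoids (addEdge uv u≢v M M∌u M∌v) w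
addEdge-avoids uv u≢v M M∌u M∌v u≢w v≢w M∌w zero    zero       = u≢w
addEdge-avoids uv u≢v M M∌u M∌v u≢w v≢w M∌w zero    (suc zero) = v≢w
addEdge-avoids uv u≢v M M∌u M∌v u≢w v≢w M∌w (suc i) a          = M∌w i a

-- Matchings from cherries

module _ {N : ℕ} {E : Fin N → Fin N → Set} where

  -- A vertex that is not a centre is at most one of the two leaves of a cherry,
  -- so each cherry has an edge that misses it.
  matchingAvoiding : ∀ {k} (B : Cherries E k) x → (∀ j → node B j zero ≢ x) →
    Σ[ M ∈ Matching E k ] Avoids M x × (∀ w → Avoids B w → Avoids M w)
  matchingAvoiding {k} B x centre≢x =
    M , M∌x , λ { w B∌w i zero → B∌w i zero ; w B∌w i (suc zero) → B∌w i _ }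
    where
    leaf : ∀ j → Σ[ a ∈ Fin 2 ] node B j (suc a) ≢ x
    leaf j with node B j (suc zero) ≟ x
    ... | no  ≢x = zero , ≢x
    ... | yes ≡x = suc zero , λ eq →
      contradiction (node-inj B j (trans ≡x (sym eq))) λ ()

    M : Matching E k
    M = subforest B id id (λ j _ → proj₁ (leaf j))
      (λ { j {zero} {zero} _ → refl }) (λ j _ → edge B j _)

    M∌x : Avoids M x
    M∌x j zero       = centre≢x j
    M∌x j (suc zero) = proj₂ (leaf j)

  -- Let c be a centre in A that B avoids.  If a leaf x of c is not a centre in B,
  -- then c x extends a matching formed by one edge of each cherry of B.
  -- Otherwise both leaves x₁ and x₂ are centres in B.  Remove the cherry of c from
  -- A and that of x₁ from B: what is left of A avoids x₂, which is still a centre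
  -- in what is left of B, so the induction hypothesis applies with the families
  -- exchanged.  It gives a matching avoiding c and x₁, to which c x₁ is added.
  -- The matching only uses vertices of A and B, which the second component records.
  cherryMatching : ∀ {k} (A B : Cherries E k) i → Avoids B (node A i zero) →
    Σ[ M ∈ Matching E (suc k) ] (∀ w → Avoids A w → Avoids B w → Avoids M w)
  cherryMatching {suc k} A B i B∌c = go (centre? zero) (centre? (suc zero))
    where
    c = node A i zero

    x : Fin 2 → Fin N
    x = node A i ∘ suc

    c≢x : ∀ a → c ≢ x a
    c≢x a eq with () ← node-inj A i eq

    centre? : ∀ a → Dec (∃[ j ] node B j zero ≡ x a)
    centre? a = any? λ j → node B j zero ≟ x a

    Goal = Σ[ M ∈ Matching E (suc (suc k)) ] (∀ w → Avoids A w → Avoids B w → Avoids M w)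

    free : ∀ a → ¬ (∃[ j ] node B j zero ≡ x a) → Goal
    free a ¬centre =
      let M , M∌x , within = matchingAvoiding B (x a) λ j eq → ¬centre (j , eq)
          M∌c = within c B∌c
      in addEdge (edge A i a) (c≢x a) M M∌c M∌x
       , λ w A∌w B∌w → addEdge-avoids (edge A i a) (c≢x a) M M∌c M∌x
           (A∌w i zero) (A∌w i (suc a)) (within w B∌w)

    go : Dec (∃[ j ] node B j zero ≡ x zero) → Dec (∃[ j ] node B j zero ≡ x (suc zero)) → Goal
    go (no ¬p) _ = free zero ¬p
    go (yes _) (no ¬p) = free (suc zero) ¬p
    go (yes (j , eq)) (yes (j′ , eq′)) =
      addEdge (edge A i zero) (c≢x zero) M M∌c M∌x
      , λ w A∌w B∌w → addEdge-avoids (edge A i zero) (c≢x zero) M M∌c M∌x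
          (A∌w i zero) (A∌w i (suc zero))
          (within w (λ l → B∌w (punchIn j l)) (λ l → A∌w (punchIn i l)))
      where
      A⁻ = reindex A (punchIn i) (punchIn-injective i _ _)
      B⁻ = reindex B (punchIn j) (punchIn-injective j _ _)

      j≢j′ : j ≢ j′
      j≢j′ refl with () ← node-inj A i (trans (sym eq) eq′)

      A⁻∌ : ∀ a → Avoids A⁻ (node A i a)
      A⁻∌ a l b = disjoint A (punchInᵢ≢i i l) b a

      centre⁻ : node B⁻ (punchOut j≢j′) zero ≡ x (suc zero)
      centre⁻ = trans (cong (λ l → node B l zero) (punchIn-punchOut j≢j′)) eq′

      IH = cherryMatching B⁻ A⁻ (punchOut j≢j′) (subst (Avoids A⁻) (sym centre⁻) (A⁻∌ (suc (suc zero))))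
      M = proj₁ IH
      within = proj₂ IH

      M∌c : Avoids M c
      M∌c = within c (λ l → B∌c (punchIn j l)) (A⁻∌ zero)

      M∌x : Avoids M (x zero)
      M∌x = within (x zero)
        (subst (Avoids B⁻) eq λ l b → disjoint B (punchInᵢ≢i j l) b zero)
        (A⁻∌ (suc zero))

-- Edge sets and their sizes

-- A set of edges on the vertex set Fin N, as a symmetric Boolean relation.  Loops
-- are not excluded, but, as in the size of a graph, only pairs u < v are counted.
record EdgeSet (N : ℕ) : Set where
  field
    has     : Fin N → Fin N → Bool
    has-sym : ∀ u v → has u v ≡ has v u

  Joins : Fin N → Fin N → Set
  Joins u v = T (has u v)

  Joins-sym : ∀ {u v} → Joins u v → Joins v u
  Joins-sym {u} {v} = subst T (has-sym u v)

  ∣_∣ : ℕ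
  ∣_∣ = sum λ u → sum λ v → if does (u <? v) ∧ has u v then 1 else 0

open EdgeSet

module _ {N : ℕ} where

  -- The pairs e and (u , v) are equal up to order.
  Same : Fin N × Fin N → Fin N → Fin N → Set
  Same (x , y) u v = (x ≡ u × y ≡ v) ⊎ (x ≡ v × y ≡ u)

  same? : ∀ e u v → Dec (Same e u v)
  same? (x , y) u v = (x ≟ u ×-dec y ≟ v) ⊎-dec (x ≟ v ×-dec y ≟ u)

  Same-swap : ∀ {x y u v} → Same (x , y) u v → Same (y , x) u v
  Same-swap (inj₁ (p , q)) = inj₂ (q , p)
  Same-swap (inj₂ (p , q)) = inj₁ (q , p)

  infixl 6 _─_

  -- Deletion of an edge.
  _─_ : EdgeSet N → Fin N × Fin N → EdgeSet N
  E ─ e = record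
    { has     = λ u v → has E u v ∧ not (does (same? e u v))
    ; has-sym = λ u v → cong₂ _∧_ (has-sym E u v) (cong not (∨-comm (does (proj₁ e ≟ u ×-dec proj₂ e ≟ v)) _))
    }

  ─-keeps : ∀ E e {u v} → ¬ Same e u v → has (E ─ e) u v ≡ has E u v
  ─-keeps E e {u} {v} ¬s rewrite dec-false (same? e u v) ¬s = ∧-identityʳ _

  ─-drops : ∀ E e {u v} → Same e u v → has (E ─ e) u v ≡ false
  ─-drops E e {u} {v} s rewrite dec-true (same? e u v) s = ∧-zeroʳ _

  ─-cases : ∀ E e {u v} → Joins E u v → Joins (E ─ e) u v ⊎ Same e u v
  ─-cases E e {u} {v} uv = case same? e u v of λ where
    (yes s) → inj₂ s
    (no ¬s) → inj₁ (subst T (sym (─-keeps E e ¬s)) uv)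

-- Two families of numbers that differ in one place, and there by one.
sum-bump : ∀ {n} {f g : Fin n → ℕ} x → f x ≡ suc (g x) → (∀ i → i ≢ x → f i ≡ g i) →
  sum f ≡ suc (sum g)
sum-bump {suc n} {f} {g} zero    fx f≗g = cong₂ _+_ fx (sum-cong-≗ (λ i → f≗g (suc i) λ ()))
sum-bump {suc n} {f} {g} (suc x) fx f≗g =
  trans (cong₂ _+_ (f≗g zero λ ()) (sum-bump x fx λ i i≢x → f≗g (suc i) (i≢x ∘ suc-injective)))
        (+-suc (g zero) _)

module _ {N : ℕ} where

  -- Only the entry (x , y) of the double sum that counts edges changes: the other
  -- orientation (y , x) is not counted as x < y.
  ∣─∣-< : ∀ (E E′ : EdgeSet N) {x y} → x Fin.< y → Joins E x y →
    has E′ x y ≡ false → (∀ {u v} → ¬ Same (x , y) u v → has E′ u v ≡ has E u v) →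
    ∣ E ∣ ≡ suc ∣ E′ ∣
  ∣─∣-< E E′ {x} {y} x<y xy ¬xy same =
    sum-bump x (sum-bump y at λ v v≢y → off x v λ { (_ , y≡v) → v≢y (sym y≡v) })
      λ u u≢x → sum-cong-≗ λ v → off u v λ { (x≡u , _) → u≢x (sym x≡u) }
    where
    w : EdgeSet N → Fin N → Fin N → ℕ
    w D u v = if does (u <? v) ∧ has D u v then 1 else 0

    at : w E x y ≡ suc (w E′ x y)
    at rewrite dec-true (x <? y) x<y | ¬xy with has E x y
    ... | true = refl

    off : ∀ u v → ¬ (x ≡ u × y ≡ v) → w E u v ≡ w E′ u v
    off u v ≢xy = case u <? v of λ where
      (no ¬u<v) → cong (λ b → if b ∧ has E u v then 1 else 0) (dec-false (u <? v) ¬u<v)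
        ⟨ trans ⟩ sym (cong (λ b → if b ∧ has E′ u v then 1 else 0) (dec-false (u <? v) ¬u<v))
      (yes u<v) → cong (λ b → if does (u <? v) ∧ b then 1 else 0) (sym (same λ where
        (inj₁ eq)            → ≢xy eq
        (inj₂ (refl , refl)) → <-asym x<y u<v))

  ∣─∣ : ∀ E {x y} → x ≢ y → Joins E x y → ∣ E ∣ ≡ suc ∣ E ─ (x , y) ∣
  ∣─∣ E {x} {y} x≢y xy with <-cmp x y
  ... | tri< x<y _ _ = ∣─∣-< E (E ─ (x , y)) x<y xy
          (─-drops E (x , y) (inj₁ (refl , refl))) (─-keeps E (x , y))
  ... | tri≈ _ x≡y _ = contradiction x≡y x≢y
  ... | tri> _ _ y<x = ∣─∣-< E (E ─ (x , y)) y<x (Joins-sym E xy)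
          (─-drops E (x , y) (inj₂ (refl , refl))) (λ ¬s → ─-keeps E (x , y) (¬s ∘ Same-swap))

  -- Deletion of a finite family of edges.
  _─*_ : ∀ {k} → EdgeSet N → (Fin k → Fin N × Fin N) → EdgeSet N
  _─*_ {zero}  E e = E
  _─*_ {suc k} E e = (E ─ e zero) ─* (e ∘ suc)

  ─*-cases : ∀ {k} E (e : Fin k → Fin N × Fin N) {u v} →
    Joins E u v → Joins (E ─* e) u v ⊎ ∃[ i ] Same (e i) u v
  ─*-cases {zero}  E e uv = inj₁ uv
  ─*-cases {suc k} E e uv with ─-cases E (e zero) uv
  ... | inj₂ s = inj₂ (zero , s)
  ... | inj₁ uv′ with ─*-cases (E ─ e zero) (e ∘ suc) uv′
  ...   | inj₁ uv″     = inj₁ uv″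
  ...   | inj₂ (i , s) = inj₂ (suc i , s)

  ∣─*∣ : ∀ {k} E (e : Fin k → Fin N × Fin N) →
    (∀ i → proj₁ (e i) ≢ proj₂ (e i)) →
    (∀ i → Joins E (proj₁ (e i)) (proj₂ (e i))) →
    (∀ {i j} → i ≢ j → ¬ Same (e i) (proj₁ (e j)) (proj₂ (e j))) →
    ∣ E ∣ ≡ k + ∣ E ─* e ∣
  ∣─*∣ {zero}  E e _    _   _    = refl
  ∣─*∣ {suc k} E e loop joins diff = trans (∣─∣ E (loop zero) (joins zero))
    (cong suc (∣─*∣ (E ─ e zero) (e ∘ suc) (loop ∘ suc)
      (λ i → case ─-cases E (e zero) (joins (suc i)) of λ where
        (inj₁ uv) → uv
        (inj₂ s)  → contradiction s (diff λ ()))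
      (λ i≢j → diff (i≢j ∘ suc-injective))))

-- The edges of the i-th star.
starEdges : ∀ {V : Set} {E : V → V → Set} {t} {m : Fin t → ℕ} (F : StarForest E m) i → Fin (m i) → V × V
starEdges F i a = node F i zero , node F i (suc a)

module _ {N t : ℕ} (E : EdgeSet N) where

  deleteStar : ∀ {m : Fin t → ℕ} (F : StarForest (Joins E) m) i →
    ∣ E ∣ ≡ m i + ∣ E ─* starEdges F i ∣
  deleteStar F i = ∣─*∣ E (starEdges F i)
    (λ a eq → case node-inj F i eq of λ ()) (edge F i)
    λ a≢b → λ where
      (inj₁ (_ , eq)) → a≢b (suc-injective (node-inj F i eq))
      (inj₂ (eq , _)) → case node-inj F i eq of λ ()

  deleteMatching : (M : Matching (Joins E) t) → ∣ E ∣ ≡ t + ∣ E ─* (λ i → starEdges M i zero) ∣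
  deleteMatching M = ∣─*∣ E (λ i → starEdges M i zero)
    (λ i eq → case node-inj M i eq of λ ()) (λ i → edge M i zero)
    λ i≢j → λ where
      (inj₁ (eq , _)) → disjoint M i≢j _ _ eq
      (inj₂ (eq , _)) → disjoint M i≢j _ _ eq

  -- A forest that avoids the centre of a star survives the deletion of the rays
  -- of that star.
  persist : ∀ {s} {m : Fin t → ℕ} {m′ : Fin s → ℕ} (F : StarForest (Joins E) m) i →
    (F′ : StarForest (Joins E) m′) → Avoids F′ (node F i zero) →
    StarForest (Joins (E ─* starEdges F i)) m′
  persist F i F′ F′∌c = record
    { node = node F′ ; node-inj = node-inj F′ ; disjoint = disjoint F′
    ; edge = λ j b → case ─*-cases E (starEdges F i) (edge F′ j b) of λ where
        (inj₁ uv)                  → uv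
        (inj₂ (_ , inj₁ (eq , _))) → contradiction (sym eq) (F′∌c j _)
        (inj₂ (_ , inj₂ (eq , _))) → contradiction (sym eq) (F′∌c j _)
    }

∣starForest∣ : ∀ {N t} (E : EdgeSet N) {m : Fin t → ℕ} → StarForest (Joins E) m → sum m ≤ ∣ E ∣
∣starForest∣ {t = zero}  E     F = z≤n
∣starForest∣ {t = suc t} E {m} F = subst (sum m ≤_) (sym (deleteStar E F zero))
  (+-monoʳ-≤ (m zero) (∣starForest∣ (E ─* starEdges F zero)
    (persist E F zero (reindex F suc suc-injective) λ i a → disjoint F (λ ()) a zero)))

-- Edge sets that miss few edges at each vertex

-- No vertex is in relation D with k distinct vertices.
NoStar : ∀ {N} → ℕ → (Fin N → Fin N → Set) → Set
NoStar {N} k D = ∀ c (f : Fin k → Fin N) → Injective _≡_ _≡_ f → ¬ (∀ i → D c (f i))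

NoStar-mono : ∀ {N k l} {D : Fin N → Fin N → Set} → k ≤ l → NoStar k D → NoStar l D
NoStar-mono k≤l none c f f-inj Dcf =
  none c (λ i → f (inject≤ i k≤l)) (λ eq → inject≤-injective k≤l k≤l _ _ (f-inj eq)) (λ i → Dcf _)

-- The edges of G that are not in E.
_∖_ : ∀ {N} → EdgeSet N → EdgeSet N → Fin N → Fin N → Set
(G ∖ E) u v = Joins G u v × ¬ Joins E u v

-- Deleting a matching costs each vertex at most one edge.  Of b + 2 deleted edges
-- at c, drop one that was still present in E, or any if there is none; the others
-- were absent from E, since the matching has at most one edge at c.
NoStar-matching : ∀ {N k b} (G E : EdgeSet N) (M : Matching (Joins E) k) → NoStar (suc b) (G ∖ E) →
  NoStar (suc (suc b)) (G ∖ (E ─* λ i → starEdges M i zero))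
NoStar-matching {k = k} G E M none c f f-inj Dcf with any? (λ i → T? (has E c (f i)))
... | no ¬ex = none c (f ∘ suc) (suc-injective ∘ f-inj)
        λ i → proj₁ (Dcf (suc i)) , λ cf → ¬ex (suc i , cf)
... | yes (i , cfi) = none c (f ∘ punchIn i) (punchIn-injective i _ _ ∘ f-inj)
        λ j → proj₁ (Dcf (punchIn i j))
            , λ cfj → punchInᵢ≢i i j (f-inj (unique (inM cfj) (inM cfi)))
  where
  InM : Fin _ → Set
  InM v = ∃[ j ] Same (starEdges M j zero) c v

  inM : ∀ {i} → Joins E c (f i) → InM (f i)
  inM {i} cf = case ─*-cases E _ cf of λ where
    (inj₁ cf′) → contradiction cf′ (proj₂ (Dcf i))
    (inj₂ s)   → s

  -- The other end of an edge of the matching.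
  other : Fin 2 → Fin 2
  other zero       = suc zero
  other (suc zero) = zero

  end : ∀ {v} → InM v → ∃[ j ] ∃[ a ] node M j a ≡ c × node M j (other a) ≡ v
  end (j , inj₁ (p , q)) = j , zero     , p , q
  end (j , inj₂ (p , q)) = j , suc zero , q , p

  unique : ∀ {v w} → InM v → InM w → v ≡ w
  unique v∈ w∈ with end v∈ | end w∈
  ... | j , a , p , refl | j′ , a′ , p′ , refl with j ≟ j′
  ...   | no j≢j′ = contradiction (trans p (sym p′)) (disjoint M j≢j′ a a′)
  ...   | yes refl with refl ← node-inj M j (trans p (sym p′)) = refl

-- Counting edges by peeling off matchings

-- The edge set G is only known through robust: every set E such that no vertex
-- has a + 1 edges of G outside E contains, for each vertex v, a star forest with
-- ray numbers m that avoids v.  The star i₀ is the one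
-- that counts twice, and v₀ is any vertex.
module LowerBound {N t : ℕ} (m : Fin t → ℕ) (2≤m : ∀ i → 2 ≤ m i) (i₀ : Fin t)
  (a : ℕ) (G : EdgeSet N) (v₀ : Fin N)
  (robust : ∀ E → NoStar (suc a) (G ∖ E) → ∀ v → Σ[ F ∈ StarForest (Joins E) m ] Avoids F v)
  where

  module _ (E : EdgeSet N) (none : NoStar (suc a) (G ∖ E)) where

    -- Two forests in E, the second avoiding the centre c of the star i₀ of the first.
    F : StarForest (Joins E) m
    F = proj₁ (robust E none v₀)

    c : Fin N
    c = node F i₀ zero

    F′ : StarForest (Joins E) m
    F′ = proj₁ (robust E none c)

    F′∌c : Avoids F′ c
    F′∌c = proj₂ (robust E none c)

    cherries : StarForest (Joins E) m → Cherries (Joins E) t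
    cherries F = subforest F id id (λ i b → inject≤ b (2≤m i))
      (λ i → inject≤-injective (2≤m i) (2≤m i) _ _) (λ i b → edge F i _)

    matching : Matching (Joins E) (suc t)
    matching = proj₁ (cherryMatching (cherries F) (cherries F′) i₀ λ i b → F′∌c i _)

    final : m i₀ + sum m ≤ ∣ E ∣
    final = subst (m i₀ + sum m ≤_) (sym (deleteStar E F i₀))
      (+-monoʳ-≤ (m i₀) (∣starForest∣ (E ─* starEdges F i₀) (persist E F i₀ F′ F′∌c)))

  -- E is what remains of G after b matchings of t + 1 edges have been deleted.
  peel : ∀ b → b ≤ a → Σ[ E ∈ EdgeSet N ] ∣ G ∣ ≡ b * suc t + ∣ E ∣ × NoStar (suc b) (G ∖ E)
  peel zero    _   = G , refl , λ c f _ D → proj₂ (D zero) (proj₁ (D zero))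
  peel (suc b) b<a =
    let E , eq , none = peel b (<⇒≤ b<a)
        M = matching E (NoStar-mono {D = G ∖ E} (s≤s (<⇒≤ b<a)) none)
        E⁻ = E ─* (λ i → starEdges M i zero)
    in E⁻
     , trans eq (trans (cong (b * suc t +_) (deleteMatching E M))
         (trans (sym (+-assoc (b * suc t) (suc t) _)) (cong (_+ ∣ E⁻ ∣) (+-comm (b * suc t) (suc t)))))
     , NoStar-matching G E M none

  lowerBound : a * suc t + (m i₀ + sum m) ≤ ∣ G ∣
  lowerBound =
    let E , eq , none = peel a ≤-refl
    in subst (_ ≤_) (sym eq) (+-monoʳ-≤ (a * suc t) (final E none))

-- Disjoint unions and embeddings

module _ (F H : Graph) where
  open Graph

  adj-↑ˡ : ∀ u v → adj (F ⊔ᴳ H) (u ↑ˡ order H) (v ↑ˡ order H) ≡ adj F u v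
  adj-↑ˡ u v rewrite splitAt-↑ˡ (order F) u (order H) | splitAt-↑ˡ (order F) v (order H) = refl

  adj-↑ʳ : ∀ u v → adj (F ⊔ᴳ H) (order F ↑ʳ u) (order F ↑ʳ v) ≡ adj H u v
  adj-↑ʳ u v rewrite splitAt-↑ʳ (order F) (order H) u | splitAt-↑ʳ (order F) (order H) v = refl

  adj-↑ˡʳ : ∀ u v → adj (F ⊔ᴳ H) (u ↑ˡ order H) (order F ↑ʳ v) ≡ false
  adj-↑ˡʳ u v rewrite splitAt-↑ˡ (order F) u (order H) | splitAt-↑ʳ (order F) (order H) v = refl

  adj-↑ʳˡ : ∀ u v → adj (F ⊔ᴳ H) (order F ↑ʳ v) (u ↑ˡ order H) ≡ false
  adj-↑ʳˡ u v = trans (adj-sym (F ⊔ᴳ H) _ _) (adj-↑ˡʳ u v)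

↑ˡ≢↑ʳ : ∀ {p q} (u : Fin p) (v : Fin q) → u ↑ˡ q ≢ p ↑ʳ v
↑ˡ≢↑ʳ {p} {q} u v eq
  with () ← trans (sym (splitAt-↑ˡ p u q)) (trans (cong (splitAt p) eq) (splitAt-↑ʳ p q v))

-- An injective map from F to V sending edges to pairs in the relation E.  Copies
-- of a given colour are the case where E is adjacency by an edge of that colour.
record Embedding (F : Graph) {V : Set} (E : V → V → Set) : Set where
  open Graph F
  field
    map       : Vertex → V
    injective : Injective _≡_ _≡_ map
    edges     : ∀ {u v} → u ~ v → E (map u) (map v)

open Embedding

module _ {F H : Graph} {V : Set} {E : V → V → Set} where
  open Graph

  restrictˡ : Embedding (F ⊔ᴳ H) E → Embedding F E
  restrictˡ ε = record
    { map       = λ u → map ε (u ↑ˡ order H)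
    ; injective = λ eq → ↑ˡ-injective (order H) _ _ (injective ε eq)
    ; edges     = λ {u} {v} e → edges ε (subst T (sym (adj-↑ˡ F H u v)) e)
    }

  restrictʳ : Embedding (F ⊔ᴳ H) E → Embedding H E
  restrictʳ ε = record
    { map       = λ u → map ε (order F ↑ʳ u)
    ; injective = λ eq → ↑ʳ-injective (order F) _ _ (injective ε eq)
    ; edges     = λ {u} {v} e → edges ε (subst T (sym (adj-↑ʳ F H u v)) e)
    }

  glue : (φ : Embedding F E) (ψ : Embedding H E) → (∀ u v → map φ u ≢ map ψ v) →
    Embedding (F ⊔ᴳ H) E
  glue φ ψ disj = record { map = g ; injective = inj ; edges = λ {u} {v} → edg u v }
    where
    g : Vertex (F ⊔ᴳ H) → V
    g u = [ map φ , map ψ ]′ (splitAt (order F) u)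

    inj : Injective _≡_ _≡_ g
    inj {u} {v} eq with splitAt (order F) u in p | splitAt (order F) v in q
    ... | inj₁ x | inj₁ y = trans (sym (splitAt⁻¹-↑ˡ p))
            (trans (cong (_↑ˡ order H) (injective φ eq)) (splitAt⁻¹-↑ˡ q))
    ... | inj₁ x | inj₂ y = contradiction eq (disj x y)
    ... | inj₂ x | inj₁ y = contradiction (sym eq) (disj y x)
    ... | inj₂ x | inj₂ y = trans (sym (splitAt⁻¹-↑ʳ p))
            (trans (cong (order F ↑ʳ_) (injective ψ eq)) (splitAt⁻¹-↑ʳ q))

    edg : ∀ u v → _~_ (F ⊔ᴳ H) u v → E (g u) (g v)
    edg u v e with splitAt (order F) u | splitAt (order F) v
    ... | inj₁ _ | inj₁ _ = edges φ e
    ... | inj₂ _ | inj₂ _ = edges ψ e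

-- The disjoint union of the stars K(1, m i).
stars : ∀ {t} → (Fin t → ℕ) → Graph
stars m = ⨆ λ i → star (m i)

-- The vertex of the union that is vertex a of the i-th star.
position : ∀ {t} (m : Fin t → ℕ) i → Fin (suc (m i)) → Graph.Vertex (stars m)
position m zero    a = a ↑ˡ Graph.order (stars (m ∘ suc))
position m (suc i) a = suc (m zero) ↑ʳ position (m ∘ suc) i a

-- The stars of a union of stars, seen as a star forest in it.
canonicalForest : ∀ {t} (m : Fin t → ℕ) → StarForest (Graph._~_ (stars m)) m
canonicalForest m = record
  { node = position m ; node-inj = inj m ; disjoint = dis m ; edge = edg m }
  where
  inj : ∀ {t} (m : Fin t → ℕ) i {a b} → position m i a ≡ position m i b → a ≡ b
  inj m zero    eq = ↑ˡ-injective (Graph.order (stars (m ∘ suc))) _ _ eq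
  inj m (suc i) eq = inj (m ∘ suc) i (↑ʳ-injective (suc (m zero)) _ _ eq)

  dis : ∀ {t} (m : Fin t → ℕ) {i j} → i ≢ j → ∀ a b → position m i a ≢ position m j b
  dis m {zero}  {zero}  i≢j a b eq = i≢j refl
  dis m {zero}  {suc j} i≢j a b eq = ↑ˡ≢↑ʳ a _ eq
  dis m {suc i} {zero}  i≢j a b eq = ↑ˡ≢↑ʳ b _ (sym eq)
  dis m {suc i} {suc j} i≢j a b eq =
    dis (m ∘ suc) (i≢j ∘ cong suc) a b (↑ʳ-injective (suc (m zero)) _ _ eq)

  edg : ∀ {t} (m : Fin t → ℕ) i a → Graph._~_ (stars m) (position m i zero) (position m i (suc a))
  edg m zero    a = subst T (sym (adj-↑ˡ (star (m zero)) (stars (m ∘ suc)) zero (suc a))) tt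
  edg m (suc i) a = subst T (sym (adj-↑ʳ (star (m zero)) (stars (m ∘ suc)) _ _)) (edg (m ∘ suc) i a)

embedding⇒forest : ∀ {V : Set} {E : V → V → Set} {t} {m : Fin t → ℕ} →
  Embedding (stars m) E → StarForest E m
embedding⇒forest {m = m} ε = record
  { node     = λ i → map ε ∘ node C i
  ; node-inj = λ i → node-inj C i ∘ injective ε
  ; disjoint = λ i≢j a b → disjoint C i≢j a b ∘ injective ε
  ; edge     = λ i → edges ε ∘ edge C i
  }
  where C = canonicalForest m

module _ {V : Set} {E : V → V → Set} (E-sym : ∀ {u v} → E u v → E v u) where

  starEmbedding : ∀ {t} {m : Fin t → ℕ} (F : StarForest E m) i → Embedding (star (m i)) E
  starEmbedding F i = record
    { map       = node F i
    ; injective = node-inj F i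
    ; edges     = λ { {zero} {suc a} _ → edge F i a ; {suc a} {zero} _ → E-sym (edge F i a) }
    }

  -- The second component, which says that the embedding stays inside the forest,
  -- gives the disjointness required to glue in the recursive step.
  forestEmbedding : ∀ {t} {m : Fin t → ℕ} (F : StarForest E m) →
    Σ[ ε ∈ Embedding (stars m) E ] (∀ x → ∃[ i ] ∃[ a ] map ε x ≡ node F i a)
  forestEmbedding {zero}  F = record { map = λ () ; injective = λ { {()} } ; edges = λ { {()} } } , λ ()
  forestEmbedding {suc t} {m} F =
    glue φ ψ (λ a y eq → let i , b , eq′ = ψ-in y in
      disjoint F {zero} {suc i} (λ ()) a b (trans eq eq′)) , located
    where
    φ = starEmbedding F zero
    ψ,in = forestEmbedding (reindex F suc suc-injective)
    ψ = proj₁ ψ,in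
    ψ-in = proj₂ ψ,in

    located : ∀ x → ∃[ i ] ∃[ a ] [ map φ , map ψ ]′ (splitAt (suc (m zero)) x) ≡ node F i a
    located x with splitAt (suc (m zero)) x
    ... | inj₁ a = zero , a , refl
    ... | inj₂ y = let i , b , eq = ψ-in y in suc i , b , eq

-- Monochromatic copies

module _ {G : Graph} (χ : Colouring G) where
  open Graph G
  open Colouring χ

  -- Adjacency by an edge of colour c.
  Mono : Colour → Vertex → Vertex → Set
  Mono c u v = Σ[ e ∈ u ~ v ] colour e ≡ c

  Mono-sym : ∀ {c u v} → Mono c u v → Mono c v u
  Mono-sym (e , eq) = ~-sym e , trans (colour-sym e) eq

  copy⇒embedding : ∀ {c F} → Copy c F G χ → Embedding F (Mono c)
  copy⇒embedding κ = record
    { map = Copy.embed κ ; injective = Copy.injective κ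
    ; edges = λ e → Copy.edge κ e , Copy.monochrom κ e }

  embedding⇒copy : ∀ {c F} → Embedding F (Mono c) → Copy c F G χ
  embedding⇒copy ε = record
    { embed = map ε ; injective = injective ε
    ; edge = proj₁ ∘ edges ε ; monochrom = proj₂ ∘ edges ε }

-- Graphs that arrow a pair of stars and a star forest

edgeSet : (G : Graph) → EdgeSet (Graph.order G)
edgeSet G = record { has = Graph.adj G ; has-sym = Graph.adj-sym G }

-- Deletion of all edges at w.
isolate : ∀ {N} → EdgeSet N → Fin N → EdgeSet N
isolate E w = record
  { has     = λ u v → has E u v ∧ not (does (u ≟ w) ∨ does (v ≟ w))
  ; has-sym = λ u v → cong₂ _∧_ (has-sym E u v) (cong not (∨-comm (does (u ≟ w)) _))
  }

isolate⁺ : ∀ {N} (E : EdgeSet N) {w u v} → Joins E u v → u ≢ w → v ≢ w → Joins (isolate E w) u v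
isolate⁺ E {w} {u} {v} uv u≢w v≢w
  rewrite dec-false (u ≟ w) u≢w | dec-false (v ≟ w) v≢w = subst T (sym (∧-identityʳ _)) uv

isolate⁻ : ∀ {N} (E : EdgeSet N) {w u v} → Joins (isolate E w) u v → Joins E u v × u ≢ w × v ≢ w
isolate⁻ E {w} {u} {v} uv with has E u v | u ≟ w | v ≟ w
... | true | no u≢w | no v≢w = tt , u≢w , v≢w

-- The colouring of G whose blue edges are those in B.
paint : (G : Graph) → EdgeSet (Graph.order G) → Colouring G
paint G B = record
  { colour     = λ {u} {v} _ → if has B u v then blue else red
  ; colour-sym = λ {u} {v} _ → cong (if_then blue else red) (has-sym B v u)
  }

paint-red : ∀ G B {u v} → Mono (paint G B) red u v → ¬ Joins B u v
paint-red G B {u} {v} (_ , eq) uv with has B u v | uv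
paint-red G B {u} {v} (_ , ()) uv | true | _

paint-blue : ∀ G B {u v} → Mono (paint G B) blue u v → Joins B u v
paint-blue G B {u} {v} (_ , eq) with has B u v
... | true = tt

module _ (G : Graph) {t n : ℕ} (m : Fin t → ℕ) (2≤m : ∀ i → 2 ≤ m i) (i₀ : Fin t)
  (arrow : G ⟶⟨ star n ⊔ᴳ star n , stars m ⟩) where
  open Graph G using (Vertex)

  someVertex : Vertex
  someVertex with arrow (paint G (edgeSet G))
  ... | inj₁ κ = Copy.embed κ zero
  ... | inj₂ κ = Copy.embed κ (position m i₀ zero)

  -- Colour blue the edges of E not at w.  A red K(1, n) avoiding w would consist of
  -- edges of G outside E, so all red copies contain w and no two are disjoint.
  -- The blue forest avoids w because each of its vertices lies on a blue edge.
  robust : ∀ E → NoStar n (edgeSet G ∖ E) → ∀ w → Σ[ F ∈ StarForest (Joins E) m ] Avoids F w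
  robust E none w = case arrow χ of λ where
      (inj₁ κ) → contradiction (copy⇒embedding χ κ) noRed
      (inj₂ κ) → blueForest (embedding⇒forest (copy⇒embedding χ κ))
    where
    B = isolate E w
    χ = paint G B

    hitsW : (σ : Embedding (star n) (Mono χ red)) → ∃[ a ] map σ a ≡ w
    hitsW σ with any? (λ a → map σ a ≟ w)
    ... | yes hit = hit
    ... | no  avoids = contradiction
            (λ i → proj₁ (ray i) , λ uv → paint-red G B (ray i)
              (isolate⁺ E uv (λ eq → avoids (_ , eq)) (λ eq → avoids (_ , eq))))
            (none (map σ zero) (map σ ∘ suc) (suc-injective ∘ injective σ))
      where
      ray : ∀ i → Mono χ red (map σ zero) (map σ (suc i))
      ray i = edges σ {zero} {suc i} tt

    noRed : ¬ Embedding (star n ⊔ᴳ star n) (Mono χ red)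
    noRed ε =
      let a , eq  = hitsW (restrictˡ {star n} {star n} ε)
          b , eq′ = hitsW (restrictʳ {star n} {star n} ε)
      in ↑ˡ≢↑ʳ a b (injective ε (trans eq (sym eq′)))

    blueForest : StarForest (Mono χ blue) m → Σ[ F ∈ StarForest (Joins E) m ] Avoids F w
    blueForest F = record
      { node = node F ; node-inj = node-inj F ; disjoint = disjoint F
      ; edge = λ i a → proj₁ (unpaint i a) } , avoids
      where
      unpaint : ∀ i a → Joins E (node F i zero) (node F i (suc a))
        × node F i zero ≢ w × node F i (suc a) ≢ w
      unpaint i a = isolate⁻ E (paint-blue G B (edge F i a))

      avoids : ∀ i a → node F i a ≢ w
      -- The centre lies on an edge because 2 ≤ m i; its first ray will do.
      avoids i zero    = proj₁ (proj₂ (unpaint i (inject≤ zero (2≤m i))))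
      avoids i (suc a) = proj₂ (proj₂ (unpaint i a))

sum-const+ : ∀ {t} a (m : Fin t → ℕ) → sum (λ i → a + m i) ≡ a * t + sum m
sum-const+ {t} a m = trans (∑-distrib-+ {t} (const a) m) (cong (_+ sum m) (sum-const t))
  where
  sum-const : ∀ t → sum {t} (const a) ≡ a * t
  sum-const zero    = sym (*-comm a 0)
  sum-const (suc t) = trans (cong (a +_) (trans (sum-const t) (*-comm a t))) (*-comm (suc t) a)

-- The lower bound with n = a + 1, where the star i₀ counts twice.
size-lower : ∀ {a t} (m : Fin t → ℕ) → (∀ i → 2 ≤ m i) → (i₀ : Fin t) → (G : Graph) →
  G ⟶⟨ star (suc a) ⊔ᴳ star (suc a) , stars m ⟩ →
  (a + m i₀) + sum (λ i → a + m i) ≤ Graph.size G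
size-lower {a} {t} m 2≤m i₀ G arrow = begin
  (a + m i₀) + sum (λ i → a + m i)
    ≡⟨ sum-const+ a (λ { zero → m i₀ ; (suc i) → m i }) ⟩
  a * suc t + (m i₀ + sum m)
    ≤⟨ lowerBound ⟩
  Graph.size G ∎
  where
  open ≤-Reasoning
  open LowerBound m 2≤m i₀ a (edgeSet G) (someVertex G m 2≤m i₀ arrow) (robust G m 2≤m i₀ arrow)

-- Sizes of disjoint unions of stars

sum-zero : ∀ {k} {f : Fin k → ℕ} → (∀ i → f i ≡ 0) → sum f ≡ 0
sum-zero {zero}  _  = refl
sum-zero {suc k} f₀ = cong₂ _+_ (f₀ zero) (sum-zero (f₀ ∘ suc))

sum-++ : ∀ p {q} (f : Fin (p + q) → ℕ) → sum f ≡ sum (λ i → f (i ↑ˡ q)) + sum (λ i → f (p ↑ʳ i))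
sum-++ zero    f = refl
sum-++ (suc p) f = trans (cong (f zero +_) (sum-++ p (f ∘ suc))) (sym (+-assoc (f zero) _ _))

<?-↑ʳ : ∀ p {q} (u v : Fin q) → does (p ↑ʳ u <? p ↑ʳ v) ≡ does (u <? v)
<?-↑ʳ zero    u v = refl
<?-↑ʳ (suc p) u v = <?-↑ʳ p u v

<?-↑ˡ : ∀ {p} q (u v : Fin p) → does (u ↑ˡ q <? v ↑ˡ q) ≡ does (u <? v)
<?-↑ˡ q u v rewrite toℕ-↑ˡ u q | toℕ-↑ˡ v q = refl

size-⊔ : ∀ F H → Graph.size (F ⊔ᴳ H) ≡ Graph.size F + Graph.size H
size-⊔ F H = trans (sum-++ (order F) _) (cong₂ _+_
  (sum-cong-≗ λ u → trans (sum-++ (order F) _) (trans (cong₂ _+_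
    (sum-cong-≗ λ v → cong₂ weight (<?-↑ˡ (order H) u v) (adj-↑ˡ F H u v))
    (zeros λ v → adj-↑ˡʳ F H u v)) (+-identityʳ _)))
  (sum-cong-≗ λ u → trans (sum-++ (order F) _) (cong₂ _+_
    (zeros λ v → adj-↑ʳˡ F H v u)
    (sum-cong-≗ λ v → cong₂ weight (<?-↑ʳ (order F) u v) (adj-↑ʳ F H u v)))))
  where
  open Graph
  weight : Bool → Bool → ℕ
  weight b c = if b ∧ c then 1 else 0

  zeros : ∀ {k} {b c : Fin k → Bool} → (∀ v → c v ≡ false) → sum (λ v → weight (b v) (c v)) ≡ 0
  zeros {b = b} none = sum-zero λ v →
    trans (cong (weight (b v)) (none v)) (cong (if_then 1 else 0) (∧-zeroʳ (b v)))

size-star : ∀ k → Graph.size (star k) ≡ k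
size-star k = trans (cong₂ _+_ (ones k) (sum-zero (λ u → sum-zero (row u)))) (+-identityʳ k)
  where
  ones : ∀ k → sum {k} (const 1) ≡ k
  ones zero    = refl
  ones (suc k) = cong suc (ones k)

  row : (u : Fin k) (v : Fin (suc k)) →
    (if does (suc u <? v) ∧ Graph.adj (star k) (suc u) v then 1 else 0) ≡ 0
  row u zero    = refl
  row u (suc v) = cong (if_then 1 else 0) (∧-zeroʳ (does (suc u <? suc v)))

size-stars : ∀ {t} (k : Fin t → ℕ) → Graph.size (stars k) ≡ sum k
size-stars {zero}  k = refl
size-stars {suc t} k = trans (size-⊔ (star (k zero)) (stars (k ∘ suc)))
  (cong₂ _+_ (size-star (k zero)) (size-stars (k ∘ suc)))

NoIsolated-star : ∀ {k} → 1 ≤ k → Graph.NoIsolated (star k)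
NoIsolated-star (s≤s _) zero    = suc zero , tt
NoIsolated-star _       (suc _) = zero , tt

NoIsolated-⊔ : ∀ F H → Graph.NoIsolated F → Graph.NoIsolated H → Graph.NoIsolated (F ⊔ᴳ H)
NoIsolated-⊔ F H nbrF nbrH u =
  subst (λ u → ∃[ v ] Graph._~_ (F ⊔ᴳ H) u v) (join-splitAt (order F) (order H) u)
    (neighbour (splitAt (order F) u))
  where
  open Graph

  neighbour : ∀ x → ∃[ v ] Graph._~_ (F ⊔ᴳ H) (join (order F) (order H) x) v
  neighbour (inj₁ x) = let v , e = nbrF x in
    v ↑ˡ order H , subst T (sym (adj-↑ˡ F H x v)) e
  neighbour (inj₂ y) = let v , e = nbrH y in
    order F ↑ʳ v , subst T (sym (adj-↑ʳ F H y v)) e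

NoIsolated-stars : ∀ {t} (k : Fin t → ℕ) → (∀ i → 1 ≤ k i) → Graph.NoIsolated (stars k)
NoIsolated-stars {suc t} k 1≤k = NoIsolated-⊔ (star (k zero)) (stars (k ∘ suc))
  (NoIsolated-star (1≤k zero)) (NoIsolated-stars (k ∘ suc) (1≤k ∘ suc))

-- Unions of stars that arrow

-- A choice of p distinct indices at which the family κ has colour c.
record Choice {k : ℕ} (κ : Fin k → Colour) (c : Colour) (p : ℕ) : Set where
  constructor choice
  field
    pick           : Fin p → Fin k
    pick-injective : Injective _≡_ _≡_ pick
    pick-colour    : ∀ a → κ (pick a) ≡ c

open Choice

Choice-mono : ∀ {k c p p′} {κ : Fin k → Colour} → p ≤ p′ → Choice κ c p′ → Choice κ c p
Choice-mono p≤p′ (choice q q-inj q-col) = choice (λ a → q (inject≤ a p≤p′))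
  (λ eq → inject≤-injective p≤p′ p≤p′ _ _ (q-inj eq)) (λ a → q-col _)

module _ {k p : ℕ} {κ : Fin (suc k) → Colour} {c : Colour} where

  skip : Choice (κ ∘ suc) c p → Choice κ c p
  skip (choice q q-inj q-col) = choice (suc ∘ q) (q-inj ∘ suc-injective) q-col

  take : κ zero ≡ c → Choice (κ ∘ suc) c p → Choice κ c (suc p)
  take κ₀ (choice q q-inj q-col) =
    choice (extend q) (extend-injective q-inj) λ { zero → κ₀ ; (suc a) → q-col a }

pigeonhole : ∀ {k} (κ : Fin k → Colour) n m → n + m ≤ suc k → Choice κ red n ⊎ Choice κ blue m
pigeonhole κ zero    m       _ = inj₁ (choice (λ ()) (λ { {()} }) λ ())
pigeonhole κ (suc n) zero    _ = inj₂ (choice (λ ()) (λ { {()} }) λ ())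
pigeonhole {zero}  κ (suc n) (suc m) (s≤s le) with () ← subst (_≤ 0) (+-suc n m) le
pigeonhole {suc k} κ (suc n) (suc m) (s≤s le) with κ zero in κ₀
... | red  = Sum.map (take κ₀) skip (pigeonhole (κ ∘ suc) n (suc m) le)
... | blue = Sum.map skip (take κ₀)
  (pigeonhole (κ ∘ suc) (suc n) m (subst (_≤ suc k) (+-suc n m) le))

-- Either P holds at two places, or Q holds at all places but one.
twoOrAllBut : ∀ {t} {P Q : Fin (suc t) → Set} → (∀ i → P i ⊎ Q i) →
  (∃[ i ] ∃[ j ] i ≢ j × P i × P j) ⊎ (∃[ j ] ∀ i → i ≢ j → Q i)
twoOrAllBut {zero}  _ = inj₂ (zero , λ { zero 0≢0 → contradiction refl 0≢0 })
twoOrAllBut {suc t} {P} {Q} f with twoOrAllBut (f ∘ suc)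
... | inj₁ (i , j , i≢j , Pi , Pj) = inj₁ (suc i , suc j , i≢j ∘ suc-injective , Pi , Pj)
... | inj₂ (j , allQ) with f zero | f (suc j)
...   | inj₂ Q₀ | _       = inj₂ (suc j , λ { zero _ → Q₀ ; (suc i) i≢j → allQ i (i≢j ∘ cong suc) })
...   | inj₁ P₀ | inj₁ Pj = inj₁ (zero , suc j , (λ ()) , P₀ , Pj)
...   | inj₁ _  | inj₂ Qj = inj₂ (zero , λ where
          zero    0≢0 → contradiction refl 0≢0
          (suc i) _   → case i ≟ j of λ where
            (yes refl) → Qj
            (no i≢j)   → allQ i i≢j)

-- The host graph has t + 1 stars: a spare star, at index zero, and one star for
-- each star of the forest.  The spare star can replace any other as m i ≤ m₀.
module UpperBound (n t : ℕ) (m : Fin t → ℕ) (m₀ : ℕ) (m≤m₀ : ∀ i → m i ≤ m₀) where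

  -- The number of blue rays that is sought in each star of the host.
  m⁺ : Fin (suc t) → ℕ
  m⁺ zero    = m₀
  m⁺ (suc i) = m i

  -- The number of rays of each star of the host.
  ray : Fin (suc t) → ℕ
  ray i = n + m⁺ i ∸ 1

  host : Graph
  host = stars ray

  size-host : Graph.size host ≡ (n + m₀ ∸ 1) + sum (λ i → n + m i ∸ 1)
  size-host = size-stars ray

  module _ (χ : Colouring host) where
    open Colouring χ

    C = canonicalForest ray

    -- The colours of the rays of the i-th star.
    κ : ∀ i → Fin (ray i) → Colour
    κ i a = colour {node C i zero} {node C i (suc a)} (edge C i a)

    forest : ∀ {c s} {p : Fin s → ℕ} (σ : Fin s → Fin (suc t)) → Injective _≡_ _≡_ σ →
      (∀ i → Choice (κ (σ i)) c (p i)) → StarForest (Mono χ c) p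
    forest σ σ-inj ch = subforest C σ σ-inj (pick ∘ ch) (pick-injective ∘ ch)
      λ i a → edge C (σ i) (pick (ch i) a) , pick-colour (ch i) a

    redPair : ∀ {i j} → i ≢ j → Choice (κ i) red n → Choice (κ j) red n →
      Copy red (star n ⊔ᴳ star n) host χ
    redPair {i} {j} i≢j chᵢ chⱼ = embedding⇒copy χ (glue
      (starEmbedding (Mono-sym χ {red}) F zero) (starEmbedding (Mono-sym χ {red}) F (suc zero))
      (disjoint F {zero} {suc zero} λ ()))
      where
      σ : Fin 2 → Fin (suc t)
      σ zero    = i
      σ (suc _) = j

      F : StarForest (Mono χ red) {2} (const n)
      F = forest σ
        (λ { {zero} {zero} _ → refl ; {zero} {suc zero} eq → contradiction eq i≢j
           ; {suc zero} {zero} eq → contradiction (sym eq) i≢j ; {suc zero} {suc zero} _ → refl })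
        λ { zero → chᵢ ; (suc zero) → chⱼ }

    blueForest : ∀ j → (∀ i → i ≢ j → Choice (κ i) blue (m⁺ i)) → Copy blue (stars m) host χ
    blueForest j blues = embedding⇒copy χ (proj₁ (forestEmbedding (Mono-sym χ) F))
      where
      -- The star of the host that receives the star i of the forest: the star suc i,
      -- or the spare star if suc i is the exceptional star j.
      Host : Fin t → Set
      Host i = Σ[ s ∈ Fin (suc t) ] Choice (κ s) blue (m i) × ((s ≡ zero × suc i ≡ j) ⊎ s ≡ suc i)

      hostOf : ∀ i → Host i
      hostOf i = case suc i ≟ j of λ where
        (no  si≢j) → suc i , blues (suc i) si≢j , inj₂ refl
        (yes si≡j) → zero , Choice-mono (m≤m₀ i) (blues zero λ { refl → case si≡j of λ () })
                          , inj₁ (refl , si≡j)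

      hostOf-injective : ∀ {i i′} → proj₁ (hostOf i) ≡ proj₁ (hostOf i′) → i ≡ i′
      hostOf-injective {i} {i′} eq with proj₂ (proj₂ (hostOf i)) | proj₂ (proj₂ (hostOf i′))
      ... | inj₁ (_ , p)  | inj₁ (_ , p′) = suc-injective (trans p (sym p′))
      ... | inj₁ (p , _)  | inj₂ p′       = case trans (sym p) (trans eq p′) of λ ()
      ... | inj₂ p        | inj₁ (p′ , _) = case trans (sym p) (trans eq p′) of λ ()
      ... | inj₂ p        | inj₂ p′       = suc-injective (trans (sym p) (trans eq p′))

      F : StarForest (Mono χ blue) m
      F = forest (proj₁ ∘ hostOf) hostOf-injective (proj₁ ∘ proj₂ ∘ hostOf)

    redOrBlue : ∀ i → Choice (κ i) red n ⊎ Choice (κ i) blue (m⁺ i)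
    redOrBlue i = pigeonhole (κ i) n (m⁺ i) (m≤n+m∸n (n + m⁺ i) 1)

    arrows : Copy red (star n ⊔ᴳ star n) host χ ⊎ Copy blue (stars m) host χ
    arrows = case twoOrAllBut redOrBlue of λ where
      (inj₁ (_ , _ , i≢j , chᵢ , chⱼ)) → inj₁ (redPair i≢j chᵢ chⱼ)
      (inj₂ (j , blues))               → inj₂ (blueForest j blues)

theorem2p4 : (n t : ℕ) → 0 < n → (0<t : 0 < t) → (m : Fin t → ℕ) →
    (∀ i j → i Fin.≤ j → m j ≤ m i) → (∀ i → 2 ≤ m i) →
    IsSizeRamsey (star n ⊔ᴳ star n) (⨆ λ i → star (m i))
    ((n + m (fromℕ< 0<t) ∸ 1) + sum (λ i → n + m i ∸ 1))
theorem2p4 (suc a) t _ 0<t m decreasing 2≤m =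
  (host , NoIsolated-stars ray 1≤ray , arrows , size-host)
  , λ { _ (G , _ , arrow , refl) → size-lower m 2≤m i₀ G arrow }
  where
  i₀ = fromℕ< 0<t

  open UpperBound (suc a) t m (m i₀)
    (λ i → decreasing i₀ i (subst (_≤ toℕ i) (sym (toℕ-fromℕ< 0<t)) z≤n))

  1≤ray : ∀ i → 1 ≤ ray i
  1≤ray zero    = ≤-trans (<⇒≤ (2≤m i₀)) (m≤n+m (m i₀) a)
  1≤ray (suc i) = ≤-trans (<⇒≤ (2≤m i)) (m≤n+m (m i) a)
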